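{- Let $\mathbf P$ be a CFSM protocol with communication graph $(N,E)$ and let $V$ be a feedback vertex set in the product graph of $\mathbf P$. There is an algorithm to decide whether any given family of recognizable relations $\mathbf R(S)\subseteq\prod_{\xi\in E}M_\xi^*$ indexed by $S\in V$ can be extended to a family of relations $\mathbf R(S)$ indexed by $S\in\prod_{j\in N}K_j$ that is consistent with respect to $\mathbf P$. Moreover, if the given family can be extended, then the smallest such relations $\mathbf R(S)$, $S\in\prod_{j\in N}K_j\setminus V$, are recognizable and can be automatically constructed.
   Context: A CFSM protocol $\mathbf P$ has a finite directed communication graph $G=(N,E)$ (edge $\xi$ has tail $-\xi$, head $+\xi$), pairwise disjoint finite message sets $M_\xi$, and for each $j\in N$ a finite state machine $F_j=(K_j,\Sigma_j,T_j,h_j)$: finite state set $K_j$, initial state $h_j$, alphabet $\Sigma_j=\{+b: b\in M_\xi,\ j=+\xi\}\cup\{ -b: b\in M_\xi,\ j=-\xi\}$, transitions $T_j\subseteq K_j\times\Sigma_j\times K_j$ ($+b$ = receive, $-b$ = send). A composite state is $S=(p_j:j\in N)$; a channel content is $C=(x_\xi:\xi\in E)$, $x_\xi\in M_\xi^*$; global states are pairs $(S,C)$. A step: some machine $F_i$ takes $p_i\xrightarrow{ -b}q_i$ with $b\in M_\beta$, $i=-\beta$, appending $b$ to the end of $x_\beta$; or takes $p_i\xrightarrow{+b}q_i$ with $b\in M_\beta$, $i=+\beta$, provided $x_\beta$ begins with $b$, removing it; all else unchanged. $\vdash^*$ means reachability by finitely many steps. The product graph of $\mathbf P$ has the composite states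 as nodes and an edge from $S=(p_j)$ to $S'=(q_j)$ iff for some $i\in N$, $p_j=q_j$ for $j\neq i$ and $F_i$ has a transition from $p_i$ to $q_i$. A feedback vertex set is a set of nodes meeting every directed cycle. A relation in $\prod_{\xi\in E}M_\xi^*$ is recognizable if it is a finite union of sets $\prod_\xi L_\xi$ with $L_\xi\subseteq M_\xi^*$ regular. A family $\mathbf R(S)$ indexed by all composite states is consistent with respect to $\mathbf P$ if $(S,C)\vdash^*(S',C')$ and $C\in\mathbf R(S)$ imply $C'\in\mathbf R(S')$. An extension agrees with the given relations on $V$; "smallest" is with respect to componentwise inclusion. -}

module Defs where

open import Data.Bool using (Bool; T)
open import Data.Fin using (Fin; zero; suc)
open import Data.List using (List; _∷_; _∷ʳ_; foldl)
open import Data.List.Membership.Propositional using () renaming (_∈_ to _∈ˡ_)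
open import Data.List.Relation.Unary.Any using (Any)
open import Data.List.Relation.Unary.Linked using (Linked)
open import Data.List.Relation.Unary.Unique.Propositional using (Unique)
open import Data.Nat using (ℕ; zero; suc)
open import Data.Product using (_×_; _,_; ∃; ∃-syntax)
open import Data.Unit using (⊤)
open import Function using (_∘_)
open import Level using (0ℓ)
open import Relation.Binary using (Rel)
open import Relation.Binary.Construct.Closure.ReflexiveTransitive using (Star)
open import Relation.Binary.PropositionalEquality using (_≡_; _≢_)
open import Relation.Unary using (Pred; _∈_; _⊆_; _≐_)

-- The product of the sets A i, i : Fin n.  It is an iterated _×_ rather than
-- a function space so that componentwise equal elements are equal (_≡_)
-- without function extensionality.
Tuple : (n : ℕ) → (Fin n → Set) → Set
Tuple zero    A = ⊤
Tuple (suc n) A = A zero × Tuple n (A ∘ suc)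

lookup : ∀ {n A} → Tuple n A → (i : Fin n) → A i
lookup {suc n} (x , xs) zero    = x
lookup {suc n} (x , xs) (suc i) = lookup xs i

AgreeExceptAt : ∀ {n A} → Fin n → Tuple n A → Tuple n A → Set
AgreeExceptAt i x y = ∀ j → j ≢ i → lookup x j ≡ lookup y j

record DFA (A : Set) : Set where
  field
    size      : ℕ
    start     : Fin size
    next      : Fin size → A → Fin size
    accepting : Fin size → Bool

  Language : Pred (List A) 0ℓ
  Language w = T (accepting (foldl next start w))

Regular : ∀ {A} → Pred (List A) 0ℓ → Set
Regular {A} L = ∃[ M ] L ≐ DFA.Language {A} M

record CommunicationGraph : Set where
  field
    nodes edges : ℕ

  Node : Set
  Node = Fin nodes

  Edge : Set
  Edge = Fin edges

  field
    tail head : Edge → Node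

-- The alphabet Σ_j, for message sets M ξ.  A message always comes with its
-- edge ξ, which is what makes the message sets pairwise disjoint.
module _ (G : CommunicationGraph) where
  open CommunicationGraph G

  data Action (M : Edge → Set) : Node → Set where
    send : ∀ ξ → M ξ → Action M (tail ξ)
    recv : ∀ ξ → M ξ → Action M (head ξ)

record Protocol : Set where
  field
    graph : CommunicationGraph

  open CommunicationGraph graph public

  field
    messages : Edge → ℕ
    states   : Node → ℕ

  Message : Edge → Set
  Message ξ = Fin (messages ξ)

  State : Node → Set
  State j = Fin (states j)

  field
    initial     : ∀ j → State j
    transitions : ∀ j → List (State j × Action graph Message j × State j)

  CompositeState : Set
  CompositeState = Tuple nodes State

  ChannelContent : Set
  ChannelContent = Tuple edges (λ ξ → List (Message ξ))

  GlobalState : Set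
  GlobalState = CompositeState × ChannelContent

  _⟨_⟩_ : ∀ {j} → State j → Action graph Message j → State j → Set
  p ⟨ a ⟩ q = (p , a , q) ∈ˡ transitions _

  data _⊢_ : Rel GlobalState 0ℓ where
    send-step : ∀ {S S′ C C′} β (b : Message β) →
      lookup S (tail β) ⟨ send β b ⟩ lookup S′ (tail β) →
      AgreeExceptAt (tail β) S S′ →
      lookup C′ β ≡ lookup C β ∷ʳ b →
      AgreeExceptAt β C C′ →
      (S , C) ⊢ (S′ , C′)
    recv-step : ∀ {S S′ C C′} β (b : Message β) →
      lookup S (head β) ⟨ recv β b ⟩ lookup S′ (head β) →
      AgreeExceptAt (head β) S S′ →
      lookup C β ≡ b ∷ lookup C′ β →
      AgreeExceptAt β C C′ →
      (S , C) ⊢ (S′ , C′)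

  _⊢*_ : Rel GlobalState 0ℓ
  _⊢*_ = Star _⊢_

  ProductEdge : Rel CompositeState 0ℓ
  ProductEdge S S′ = ∃[ i ] AgreeExceptAt i S S′ ×
                            ∃[ a ] (lookup S i ⟨ a ⟩ lookup S′ i)

  -- S → S₁ → ⋯ → Sₖ → S with S, S₁, …, Sₖ distinct; k = 0 is a self-loop.
  DirectedCycle : CompositeState → List CompositeState → Set
  DirectedCycle S Ss = Unique (S ∷ Ss) × Linked ProductEdge ((S ∷ Ss) ∷ʳ S)

  -- A set of composite states is given by its characteristic function.
  FeedbackVertexSet : (CompositeState → Bool) → Set
  FeedbackVertexSet V = ∀ S Ss → DirectedCycle S Ss → Any (T ∘ V) (S ∷ Ss)

  Relation : Set₁
  Relation = Pred ChannelContent 0ℓ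

  Recognizable : Relation → Set₁
  Recognizable ρ =
    ∃[ n ] ∃ λ (L : Fin n → (ξ : Edge) → Pred (List (Message ξ)) 0ℓ) →
      (∀ k ξ → Regular (L k ξ)) ×
      ρ ≐ (λ C → ∃[ k ] ∀ ξ → lookup C ξ ∈ L k ξ)

  Family : Set₁
  Family = CompositeState → Relation

  FamilyOn : (CompositeState → Bool) → Set₁
  FamilyOn V = ∀ S → T (V S) → Relation

  Consistent : Family → Set
  Consistent R = ∀ {S C S′ C′} → (S , C) ⊢* (S′ , C′) → C ∈ R S → C′ ∈ R S′

  module _ {V : CompositeState → Bool} (R₀ : FamilyOn V) where

    ConsistentExtension : Family → Set
    ConsistentExtension R = (∀ S (v : T (V S)) → R S ≐ R₀ S v) × Consistent R

    Extendable : Set₁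
    Extendable = ∃[ R ] ConsistentExtension R

    SmallestConsistentExtension : Family → Set₁
    SmallestConsistentExtension R =
      ConsistentExtension R ×
      (∀ R′ → ConsistentExtension R′ → ∀ S → R S ⊆ R′ S)

{-# OPTIONS --safe #-}

-- The smallest consistent family contains, at S ∉ V, the contents reached by
-- computations that start in a given relation and then avoid V.  Outside V the
-- product graph is acyclic, so such computations visit no composite state twice
-- and their length is bounded by the number of composite states; the family is
-- thus obtained from the given relations by finitely many unions and images
-- under single sends and receives, all of which preserve recognizability.  An
-- extension exists iff no further step leads from this family into some S ∈ V
-- outside the given relation, which is a decidable inclusion of recognizable
-- relations.
module Submission where

open import Data.Bool using (Bool; true; false; T; _∧_)
open import Data.Bool.Properties using (T?; T-irrelevant; T-∧)
open import Data.Empty using (⊥-elim)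
open import Data.Fin as Fin using (Fin; zero; suc; toℕ)
open import Data.Fin.Properties as Fin using (all?; pigeonhole; toℕ<n)
open import Data.List as List using (List; []; _∷_; [_]; _++_; _∷ʳ_; _ʳ++_; allFin; cartesianProduct; cartesianProductWith; concatMap; drop; foldl; length; map; reverse; take)
open import Data.List.Membership.Propositional using (find; lose) renaming (_∈_ to _∈ˡ_)
open import Data.List.Membership.Propositional.Properties using (∈-++⁺ˡ; ∈-++⁺ʳ; ∈-∃++; ∈-allFin; ∈-cartesianProduct⁺; ∈-cartesianProductWith⁺; ∈-lookup)
open import Data.List.Properties using (foldl-++; foldl-∷ʳ; length-++; length-drop; length-take; take++drop≡id; ʳ++-defn)
open import Data.List.Relation.Binary.Permutation.Propositional as ↭ using (_↭_; ↭⇒↭ₛ)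
open import Data.List.Relation.Binary.Permutation.Propositional.Properties using (All-resp-↭; shift; ↭-reverse; ++⁺ʳ)
import Data.List.Relation.Binary.Permutation.Setoid.Properties as Permutationₛ
open import Data.List.Relation.Unary.All as All using (All; []; _∷_)
open import Data.List.Relation.Unary.All.Properties using (All¬⇒¬Any; ++⁻ˡ)
open import Data.List.Relation.Unary.AllPairs using ([]; _∷_)
open import Data.List.Relation.Unary.Any as Any using (Any; here; there)
open import Data.List.Relation.Unary.Any.Properties as Any using (concatMap⁺; concatMap⁻; lookup-index)
open import Data.List.Relation.Unary.Linked as Linked using (Linked; []; [-]; _∷_)
open import Data.List.Relation.Unary.Unique.Propositional using (Unique)
open import Data.List.Reverse using ([]; _∶_∶ʳ_; reverseView)
open import Data.Nat as ℕ using (ℕ; zero; suc; _≤_; _<_; s≤s; _+_; _∸_)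
open import Data.Nat.Induction using (<-wellFounded)
import Data.Nat.Properties as ℕ
open import Data.Product using (_×_; _,_; ∃-syntax; proj₁; proj₂)
open import Data.Unit using (tt)
open import Function using (_∘_; case_of_; flip; id; Equivalence)
open import Induction.WellFounded using (Acc; acc)
open import Level using (0ℓ)
open import Relation.Binary using (Rel)
open import Relation.Binary.Construct.Closure.ReflexiveTransitive using (ε; _◅_)
open import Relation.Binary.PropositionalEquality using (_≡_; _≢_; refl; sym; trans; cong; subst; setoid; module ≡-Reasoning)
open import Relation.Nullary using (Dec; ¬_; yes; no; contradiction)
open import Relation.Nullary.Decidable using (isYes; map′; ¬?; _×-dec_; _→-dec_; toWitness; fromWitness)
open import Relation.Unary using (Pred; _∈_; _⊆_; _≐_)
open import Defs

-- Products of finite sets.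

tabulate : ∀ {n} {A : Fin n → Set} → (∀ i → A i) → Tuple n A
tabulate {zero}  f = tt
tabulate {suc n} f = f zero , tabulate (f ∘ suc)

lookup∘tabulate : ∀ {n} {A : Fin n → Set} (f : ∀ i → A i) i → lookup (tabulate {A = A} f) i ≡ f i
lookup∘tabulate f zero    = refl
lookup∘tabulate f (suc i) = lookup∘tabulate (f ∘ suc) i

tuples : ∀ {n} {A : Fin n → Set} → (∀ i → List (A i)) → List (Tuple n A)
tuples {zero}  xs = [ tt ]
tuples {suc n} xs = cartesianProduct (xs zero) (tuples (xs ∘ suc))

∈-tuples⁺ : ∀ {n} {A : Fin n → Set} (xs : ∀ i → List (A i)) (t : Tuple n A) →
  (∀ i → lookup t i ∈ˡ xs i) → t ∈ˡ tuples xs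
∈-tuples⁺ {zero}  xs tt      t∈ = here refl
∈-tuples⁺ {suc n} xs (x , t) t∈ = ∈-cartesianProduct⁺ (t∈ zero) (∈-tuples⁺ (xs ∘ suc) t (t∈ ∘ suc))

-- Repetitions are allowed: `encode` picks one position of each element, and the length is an upper
-- bound for the cardinality.
Enumeration : Set → Set
Enumeration X = ∃[ xs ] ∀ (x : X) → x ∈ˡ xs

-- Pigeonhole arguments over an enumerated type.

module _ {X : Set} (enumeration : Enumeration X) where
  private
    xs : List X
    xs = proj₁ enumeration

  encode : X → Fin (length xs)
  encode x = Any.index (proj₂ enumeration x)

  decode : Fin (length xs) → X
  decode = List.lookup xs

  decode∘encode : ∀ x → decode (encode x) ≡ x
  decode∘encode x = sym (lookup-index (proj₂ enumeration x))

  encode-injective : ∀ {x y} → encode x ≡ encode y → x ≡ y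
  encode-injective {x} {y} eq =
    trans (sym (decode∘encode x)) (trans (cong decode eq) (decode∘encode y))

  Unique⇒length≤ : ∀ {ys} → Unique ys → length ys ≤ length xs
  Unique⇒length≤ {ys} u = Fin.injective⇒≤ {f = encode ∘ List.lookup ys}
    (lookup-injective u ∘ encode-injective)
    where
    lookup-injective : ∀ {ys : List X} → Unique ys → ∀ {i j} → List.lookup ys i ≡ List.lookup ys j → i ≡ j
    lookup-injective (y≢ ∷ u) {zero}  {zero}  eq = refl
    lookup-injective (y≢ ∷ u) {zero}  {suc j} eq = contradiction eq (All.lookup y≢ (∈-lookup j))
    lookup-injective (y≢ ∷ u) {suc i} {zero}  eq = contradiction (sym eq) (All.lookup y≢ (∈-lookup i))
    lookup-injective (y≢ ∷ u) {suc i} {suc j} eq = cong suc (lookup-injective u eq)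

  -- Two prefixes of `w` reach the same state; deleting the letters between them leaves the final
  -- state unchanged.
  shorten : ∀ {A : Set} (step : X → A → X) s w → length xs ≤ length w →
    ∃[ w′ ] length w′ < length w × foldl step s w ≡ foldl step s w′
  shorten step s w long
    -- A word has `suc (length w)` prefixes, more than there are entries in `xs`.
    with i , j , i<j , eq ← pigeonhole (s≤s long) (λ i → encode (foldl step s (take (toℕ i) w)))
    = take (toℕ i) w ++ drop (toℕ j) w , shorter , same
    where
    shorter : length (take (toℕ i) w ++ drop (toℕ j) w) < length w
    shorter = begin-strict
      length (take (toℕ i) w ++ drop (toℕ j) w)         ≡⟨ length-++ (take (toℕ i) w) ⟩
      length (take (toℕ i) w) + length (drop (toℕ j) w) ≡⟨ cong (length (take (toℕ i) w) +_) (length-drop (toℕ j) w) ⟩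
      length (take (toℕ i) w) + (length w ∸ toℕ j)      ≤⟨ ℕ.+-monoˡ-≤ _ take≤ ⟩
      toℕ i + (length w ∸ toℕ j)                        <⟨ ℕ.+-monoˡ-< _ i<j ⟩
      toℕ j + (length w ∸ toℕ j)                        ≡⟨ ℕ.m+[n∸m]≡n (ℕ.≤-pred (toℕ<n j)) ⟩
      length w                                          ∎
      where
      open ℕ.≤-Reasoning

      take≤ : length (take (toℕ i) w) ≤ toℕ i
      take≤ = subst (_≤ toℕ i) (sym (length-take (toℕ i) w)) (ℕ.m⊓n≤m (toℕ i) (length w))

    same : foldl step s w ≡ foldl step s (take (toℕ i) w ++ drop (toℕ j) w)
    same = begin
      foldl step s w                                              ≡⟨ cong (foldl step s) (take++drop≡id (toℕ j) w) ⟨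
      foldl step s (take (toℕ j) w ++ drop (toℕ j) w)             ≡⟨ foldl-++ step s (take (toℕ j) w) _ ⟩
      foldl step (foldl step s (take (toℕ j) w)) (drop (toℕ j) w) ≡⟨ cong (λ q → foldl step q (drop (toℕ j) w)) (encode-injective eq) ⟨
      foldl step (foldl step s (take (toℕ i) w)) (drop (toℕ j) w) ≡⟨ foldl-++ step s (take (toℕ i) w) _ ⟨
      foldl step s (take (toℕ i) w ++ drop (toℕ j) w)             ∎
      where open ≡-Reasoning

  short-word : ∀ {A : Set} (step : X → A → X) s w →
    ∃[ w′ ] length w′ ≤ length xs × foldl step s w ≡ foldl step s w′
  short-word step s w = go w (<-wellFounded (length w))
    where
    go : ∀ w → Acc _<_ (length w) → ∃[ w′ ] length w′ ≤ length xs × foldl step s w ≡ foldl step s w′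
    go w (acc rec) with length w ℕ.≤? length xs
    ... | yes short = w , short , refl
    ... | no  long  =
      let w₁ , w₁<w , eq₁ = shorten step s w (ℕ.<⇒≤ (ℕ.≰⇒> long))
          w₂ , short , eq₂ = go w₁ (rec w₁<w)
      in w₂ , short , trans eq₁ eq₂

-- Finitely many words that represent all words for given automata.

words : ∀ m → ℕ → List (List (Fin m))
words m zero    = [ [] ]
words m (suc n) = [] ∷ cartesianProductWith _∷_ (allFin m) (words m n)

∈-words⁺ : ∀ {m} n (w : List (Fin m)) → length w ≤ n → w ∈ˡ words m n
∈-words⁺ zero    []      _         = here refl
∈-words⁺ (suc n) []      _         = here refl
∈-words⁺ (suc n) (a ∷ w) (s≤s len) = there (∈-cartesianProductWith⁺ _∷_ (∈-allFin a) (∈-words⁺ n w len))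

run : ∀ {A} (M : DFA A) → List A → Fin (DFA.size M)
run M = foldl (DFA.next M) (DFA.start M)

-- Run in parallel, the automata form one automaton on tuples of states. Each tuple that is reached
-- at all is reached by a word no longer than the list of tuples.
representatives : ∀ {m k} (M : Fin k → DFA (Fin m)) →
  ∃[ ws ] ∀ w → ∃[ w′ ] w′ ∈ˡ ws × ∀ i → run (M i) w ≡ run (M i) w′
representatives {m} {k} M = words m (length (proj₁ allStates)) , λ w →
  let w′ , short , eq = short-word allStates step start w
  in w′ , ∈-words⁺ _ w′ short , λ i →
       trans (sym (run-step i w)) (trans (cong (λ t → lookup t i) eq) (run-step i w′))
  where
  States : Set
  States = Tuple k (λ i → Fin (DFA.size (M i)))

  allStates : Enumeration States
  allStates = tuples (λ i → allFin _) , λ t → ∈-tuples⁺ _ t (λ i → ∈-allFin _)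

  step : States → Fin m → States
  step t a = tabulate (λ i → DFA.next (M i) (lookup t i) a)

  start : States
  start = tabulate (λ i → DFA.start (M i))

  lookup-foldl : ∀ i t w → lookup (foldl step t w) i ≡ foldl (DFA.next (M i)) (lookup t i) w
  lookup-foldl i t []      = refl
  lookup-foldl i t (a ∷ w) = trans (lookup-foldl i (step t a) w)
    (cong (λ q → foldl (DFA.next (M i)) q w) (lookup∘tabulate (λ i → DFA.next (M i) (lookup t i) a) i))

  run-step : ∀ i w → lookup (foldl step start w) i ≡ run (M i) w
  run-step i w = trans (lookup-foldl i start w)
    (cong (λ q → foldl (DFA.next (M i)) q w) (lookup∘tabulate (λ i → DFA.start (M i)) i))

-- Appending a letter to a regular language.

module _ {m} (b : Fin m) (M : DFA (Fin m)) where
  open DFA M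

  -- The flag records that the last letter read was b and that the word
  -- before it was accepted by M.
  private
    Flagged : Set
    Flagged = Fin size × Bool

    flaggedStates : Enumeration Flagged
    flaggedStates = cartesianProduct (allFin size) (true ∷ false ∷ []) , λ where
      (q , true)  → ∈-cartesianProduct⁺ (∈-allFin q) (here refl)
      (q , false) → ∈-cartesianProduct⁺ (∈-allFin q) (there (here refl))

    step : Flagged → Fin m → Flagged
    step (q , _) a = next q a , accepting q ∧ isYes (a Fin.≟ b)

  snocDFA : DFA (Fin m)
  snocDFA = record
    { size      = length (proj₁ flaggedStates)
    -- The flag starts as `false` because the empty word does not end in `b`.
    ; start     = encode flaggedStates (start , false)
    ; next      = λ q a → encode flaggedStates (step (decode flaggedStates q) a)
    ; accepting = proj₂ ∘ decode flaggedStates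
    }

  private
    decode-foldl : ∀ s w → decode flaggedStates (foldl (DFA.next snocDFA) (encode flaggedStates s) w) ≡ foldl step s w
    decode-foldl s []      = decode∘encode flaggedStates s
    decode-foldl s (a ∷ w) rewrite decode∘encode flaggedStates s = decode-foldl (step s a) w

    proj₁-foldl : ∀ s w → proj₁ (foldl step s w) ≡ foldl next (proj₁ s) w
    proj₁-foldl s []      = refl
    proj₁-foldl s (a ∷ w) = proj₁-foldl (step s a) w

    flag-∷ʳ : ∀ w a → proj₂ (decode flaggedStates (run snocDFA (w ∷ʳ a))) ≡ accepting (run M w) ∧ isYes (a Fin.≟ b)
    flag-∷ʳ w a
      rewrite decode-foldl (start , false) (w ∷ʳ a)
            | foldl-∷ʳ step (start , false) a w
            | proj₁-foldl (start , false) w = refl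

  snocDFA-sound : ∀ {w} → w ∈ DFA.Language snocDFA → ∃[ u ] w ≡ u ∷ʳ b × u ∈ Language
  snocDFA-sound {w} w∈ with reverseView w
  ... | [] = ⊥-elim (subst (T ∘ proj₂) (decode∘encode flaggedStates (start , false)) w∈)
  ... | u ∶ _ ∶ʳ a =
    let u∈ , a≡b = Equivalence.to T-∧ (subst T (flag-∷ʳ u a) w∈)
    in u , cong (u ∷ʳ_) (toWitness {a? = a Fin.≟ b} a≡b) , u∈

  snocDFA-complete : ∀ {u} → u ∈ Language → u ∷ʳ b ∈ DFA.Language snocDFA
  snocDFA-complete {u} u∈ = subst T (sym (flag-∷ʳ u b))
    (Equivalence.from T-∧ (u∈ , fromWitness {a? = b Fin.≟ b} refl))

-- Updates of dependent functions and conditional lists.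

update : ∀ {n} {A : Fin n → Set} (i : Fin n) → A i → (∀ j → A j) → ∀ j → A j
update i x f j with i Fin.≟ j
... | yes refl = x
... | no  _    = f j

update-at : ∀ {n} {A : Fin n → Set} (i : Fin n) (x : A i) (f : ∀ j → A j) → update {A = A} i x f i ≡ x
update-at i x f with i Fin.≟ i
... | yes refl = refl
... | no  i≢i  = contradiction refl i≢i

update-off : ∀ {n} {A : Fin n → Set} (i : Fin n) (x : A i) (f : ∀ j → A j) {j} → j ≢ i → update {A = A} i x f j ≡ f j
update-off i x f {j} j≢i with i Fin.≟ j
... | yes refl = contradiction refl j≢i
... | no  _    = refl

guard : ∀ {P A : Set} → Dec P → List A → List A
guard (yes _) xs = xs
guard (no  _) xs = []

Any-guard⁺ : ∀ {P A : Set} {Q : Pred A 0ℓ} (P? : Dec P) {xs} → P → Any Q xs → Any Q (guard P? xs)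
Any-guard⁺ (yes _) p q = q
Any-guard⁺ (no ¬p) p q = contradiction p ¬p

Any-guard⁻ : ∀ {P A : Set} {Q : Pred A 0ℓ} (P? : Dec P) {xs} → Any Q (guard P? xs) → P × Any Q xs
Any-guard⁻ (yes p) q = p , q

-- Simple cycles in walks.

module _ {X : Set} {_⟶_ : Rel X 0ℓ} where

  -- Walks list their last vertex first, cycles run forwards. The stretch from `u` back to `x` is
  -- turned around onto an accumulator that already runs forwards from `u`.
  Linked-reverse : ∀ {u x zs acc} ys → Linked (flip _⟶_) (u ∷ ys ++ x ∷ zs) → Linked _⟶_ (u ∷ acc) →
    Linked _⟶_ (x ∷ (ys ʳ++ u ∷ acc))
  Linked-reverse []       (x⟶u ∷ _) l = x⟶u ∷ l
  Linked-reverse (y ∷ ys) (y⟶u ∷ k) l = Linked-reverse ys k (y⟶u ∷ l)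

  -- A repetition in a walk closes a cycle, and the cycle is simple if the
  -- walk had no repetition before.
  walk-Unique : {P : Pred X 0ℓ} →
    (∀ x xs → Unique (x ∷ xs) → Linked _⟶_ ((x ∷ xs) ∷ʳ x) → Any P (x ∷ xs)) →
    ∀ {xs} → Linked (flip _⟶_) xs → All (¬_ ∘ P) xs → Unique xs
  walk-Unique meets {[]}     l []         = []
  walk-Unique meets {x ∷ xs} l (¬px ∷ ¬p) =
    All.tabulate (λ y∈ x≡y → x∉xs (subst (_∈ˡ xs) (sym x≡y) y∈)) ∷ u
    where
    u : Unique xs
    u = walk-Unique meets (Linked.tail l) ¬p

    x∉xs : ¬ x ∈ˡ xs
    x∉xs x∈xs with ys , zs , refl ← ∈-∃++ x∈xs =
      All¬⇒¬Any (++⁻ˡ (x ∷ reverse ys) (All-resp-↭ perm ¬p))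
        (meets x (reverse ys)
          (Unique-++⁻ˡ (x ∷ reverse ys) (Permutationₛ.Unique-resp-↭ (setoid X) (↭⇒↭ₛ perm) u))
          (subst (λ vs → Linked _⟶_ (x ∷ vs)) (ʳ++-defn ys) (Linked-reverse ys l [-])))
      where
      -- Distinctness and avoidance of `P` are known for `xs`; the permutation carries both to the
      -- cycle.
      perm : ys ++ x ∷ zs ↭ (x ∷ reverse ys) ++ zs
      perm = ↭.trans (shift x ys zs) (↭.prep x (++⁺ʳ zs (↭.↭-sym (↭-reverse ys))))

      Unique-++⁻ˡ : ∀ vs {ws : List X} → Unique (vs ++ ws) → Unique vs
      Unique-++⁻ˡ []       _        = []
      Unique-++⁻ˡ (v ∷ vs) (v≢ ∷ u) = ++⁻ˡ vs v≢ ∷ Unique-++⁻ˡ vs u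

-- Recognizable relations as finite lists of boxes.

module _ (P : Protocol) where
  open Protocol P

  -- A product of regular languages, given by automata so that relations can be computed with; a
  -- list of boxes stands for its union.
  Box : Set
  Box = ∀ ξ → DFA (Message ξ)

  _∈□_ : ChannelContent → Box → Set
  C ∈□ B = ∀ ξ → lookup C ξ ∈ DFA.Language (B ξ)

  ⟦_⟧ : List Box → Relation
  ⟦ Bs ⟧ C = Any (C ∈□_) Bs

  ⟦⟧-recognizable : ∀ Bs → Recognizable ⟦ Bs ⟧
  ⟦⟧-recognizable Bs =
    length Bs , (λ k ξ → DFA.Language (List.lookup Bs k ξ)) ,
    (λ k ξ → List.lookup Bs k ξ , id , id) ,
    (λ C∈ → Any.index C∈ , lookup-index C∈) , λ (k , C∈) → lose (∈-lookup k) C∈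

  boxes : ∀ {ρ} → Recognizable ρ → List Box
  boxes (n , L , reg , _) = List.tabulate (λ k ξ → proj₁ (reg k ξ))

  boxes-correct : ∀ {ρ} (r : Recognizable ρ) → ⟦ boxes r ⟧ ≐ ρ
  boxes-correct (n , L , reg , ρ⊆ , ⊆ρ) =
    (λ C∈ → let k , C∈k = Any.tabulate⁻ C∈ in ⊆ρ (k , λ ξ → proj₂ (proj₂ (reg k ξ)) (C∈k ξ))) ,
    (λ C∈ → let k , C∈k = ρ⊆ C∈ in Any.tabulate⁺ k (λ ξ → proj₁ (proj₂ (reg k ξ)) (C∈k ξ)))

  _∈?_ : ∀ C Bs → Dec (C ∈ ⟦ Bs ⟧)
  C ∈? Bs = Any.any? (λ B → all? (λ ξ → T? _)) Bs

  -- Membership in a box only depends on the states reached by its automata,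
  -- so finitely many channel contents decide the inclusion.
  _⊆?_ : ∀ Bs Bs′ → Dec (∀ C → C ∈ ⟦ Bs ⟧ → C ∈ ⟦ Bs′ ⟧)
  Bs ⊆? Bs′ = map′ (λ h C → transfer C (All.lookup h (proj₁ (proj₂ (rep C)))) (proj₂ (proj₂ (rep C))))
                   (λ h → All.tabulate (λ _ → h _))
                   (All.all? (λ C → (C ∈? Bs) →-dec (C ∈? Bs′)) contents)
    where
    all-boxes : List Box
    all-boxes = Bs ++ Bs′

    _≈_ : Rel ChannelContent 0ℓ
    C ≈ C′ = ∀ {B} → B ∈ˡ all-boxes → ∀ ξ → run (B ξ) (lookup C ξ) ≡ run (B ξ) (lookup C′ ξ)

    -- The words chosen for one channel serve the automata of all boxes at once. A box constrains
    -- each channel separately, so the choices combine freely.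
    reps : ∀ ξ → ∃[ ws ] ∀ w → ∃[ w′ ] w′ ∈ˡ ws × ∀ k →
      run (List.lookup all-boxes k ξ) w ≡ run (List.lookup all-boxes k ξ) w′
    reps ξ = representatives (λ k → List.lookup all-boxes k ξ)

    contents : List ChannelContent
    contents = tuples (λ ξ → proj₁ (reps ξ))

    rep : ∀ C → ∃[ C′ ] C′ ∈ˡ contents × C ≈ C′
    rep C = tabulate word , ∈-tuples⁺ _ _ word∈ , C≈
      where
      word : ∀ ξ → List (Message ξ)
      word ξ = proj₁ (proj₂ (reps ξ) (lookup C ξ))

      word∈ : ∀ ξ → lookup (tabulate word) ξ ∈ˡ proj₁ (reps ξ)
      word∈ ξ rewrite lookup∘tabulate word ξ = proj₁ (proj₂ (proj₂ (reps ξ) (lookup C ξ)))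

      C≈ : C ≈ tabulate word
      C≈ B∈ ξ rewrite lookup∘tabulate word ξ | lookup-index B∈ =
        proj₂ (proj₂ (proj₂ (reps ξ) (lookup C ξ))) (Any.index B∈)

    transfer : ∀ C {C′} → (C′ ∈ ⟦ Bs ⟧ → C′ ∈ ⟦ Bs′ ⟧) → C ≈ C′ → C ∈ ⟦ Bs ⟧ → C ∈ ⟦ Bs′ ⟧
    transfer C {C′} h C≈C′ C∈ =
      let B  , B∈  , C∈B   = find C∈
          B′ , B′∈ , C′∈B′ = find (h (lose B∈ (λ ξ → subst (T ∘ DFA.accepting (B ξ)) (C≈C′ (∈-++⁺ˡ B∈) ξ) (C∈B ξ))))
      in lose B′∈ (λ ξ → subst (T ∘ DFA.accepting (B′ ξ)) (sym (C≈C′ (∈-++⁺ʳ Bs B′∈) ξ)) (C′∈B′ ξ))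

  -- Single sends and receives.

  channel : ∀ {j} → Action graph Message j → Edge
  channel (send ξ b) = ξ
  channel (recv ξ b) = ξ

  Effect : ∀ {j} (a : Action graph Message j) → Rel (List (Message (channel a))) 0ℓ
  Effect (send ξ b) w w′ = w′ ≡ w ∷ʳ b
  Effect (recv ξ b) w w′ = w ≡ b ∷ w′

  -- A send turns L into L b. A receive turns L into its left quotient by b, recognized by moving
  -- the start state along `b`.
  image : ∀ {j} (a : Action graph Message j) → DFA (Message (channel a)) → DFA (Message (channel a))
  image (send ξ b) M = snocDFA b M
  image (recv ξ b) M = record M { start = DFA.next M (DFA.start M) b }

  image-sound : ∀ {j} (a : Action graph Message j) M {w′} → w′ ∈ DFA.Language (image a M) →
    ∃[ w ] Effect a w w′ × w ∈ DFA.Language M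
  image-sound (send ξ b) M {w′} w′∈ = snocDFA-sound b M w′∈
  image-sound (recv ξ b) M {w′} w′∈ = b ∷ w′ , refl , w′∈

  image-complete : ∀ {j} (a : Action graph Message j) M {w w′} → Effect a w w′ → w ∈ DFA.Language M →
    w′ ∈ DFA.Language (image a M)
  image-complete (send ξ b) M {w} refl w∈ = snocDFA-complete b M {w} w∈
  image-complete (recv ξ b) M refl w∈ = w∈

  Fires : ∀ {j} → Action graph Message j → Rel ChannelContent 0ℓ
  Fires a C C′ = Effect a (lookup C (channel a)) (lookup C′ (channel a)) × AgreeExceptAt (channel a) C C′

  fire : ∀ {j} → Action graph Message j → Box → Box
  fire a B = update (channel a) (image a (B (channel a))) B

  fire-sound : ∀ {j} (a : Action graph Message j) B {C′} → C′ ∈□ fire a B → ∃[ C ] Fires a C C′ × C ∈□ B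
  fire-sound a B {C′} C′∈ = tabulate C , (effect′ , agree) , C∈
    where
    β : Edge
    β = channel a

    pre : ∃[ w ] Effect a w (lookup C′ β) × w ∈ DFA.Language (B β)
    pre = image-sound a (B β) (subst (λ M → lookup C′ β ∈ DFA.Language M) (update-at β (image a (B β)) B) (C′∈ β))

    C : ∀ ξ → List (Message ξ)
    -- Only the acting channel differs from `C′`; there it holds a word that the action turns into
    -- the content of `C′`.
    C = update β (proj₁ pre) (lookup C′)

    C-β : lookup (tabulate C) β ≡ proj₁ pre
    C-β = trans (lookup∘tabulate C β) (update-at β (proj₁ pre) (lookup C′))

    effect′ : Effect a (lookup (tabulate C) β) (lookup C′ β)
    effect′ = subst (λ w → Effect a w (lookup C′ β)) (sym C-β) (proj₁ (proj₂ pre))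

    agree : AgreeExceptAt β (tabulate C) C′
    agree ξ ξ≢β = trans (lookup∘tabulate C ξ) (update-off β (proj₁ pre) (lookup C′) ξ≢β)

    C∈ : tabulate C ∈□ B
    C∈ ξ with ξ Fin.≟ β
    ... | yes refl = subst (_∈ DFA.Language (B β)) (sym C-β) (proj₂ (proj₂ pre))
    ... | no  ξ≢β  = subst (_∈ DFA.Language (B ξ)) (sym (agree ξ ξ≢β))
      (subst (λ M → lookup C′ ξ ∈ DFA.Language M) (update-off β (image a (B β)) B ξ≢β) (C′∈ ξ))

  fire-complete : ∀ {j} (a : Action graph Message j) B {C C′} → Fires a C C′ → C ∈□ B → C′ ∈□ fire a B
  fire-complete a B {C} {C′} (effect , agree) C∈ ξ with channel a Fin.≟ ξ
  ... | yes refl = image-complete a (B ξ) effect (C∈ ξ)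
  ... | no  β≢ξ  = subst (_∈ DFA.Language (B ξ)) (agree ξ (β≢ξ ∘ sym)) (C∈ ξ)

  -- `_⊢_` with its two constructors merged by quantifying over actions, so that sends and receives
  -- are treated alike.
  Step : Rel GlobalState 0ℓ
  Step (S , C) (S′ , C′) = ∃[ j ] ∃[ a ] (lookup S j ⟨ a ⟩ lookup S′ j) × AgreeExceptAt j S S′ × Fires a C C′

  ⊢⇒Step : ∀ {x y} → x ⊢ y → Step x y
  ⊢⇒Step (send-step β b t agree eq agree′) = tail β , send β b , t , agree , eq , agree′
  ⊢⇒Step (recv-step β b t agree eq agree′) = head β , recv β b , t , agree , eq , agree′

  Step⇒⊢ : ∀ {x y} → Step x y → x ⊢ y
  Step⇒⊢ (_ , send β b , t , agree , eq , agree′) = send-step β b t agree eq agree′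
  Step⇒⊢ (_ , recv β b , t , agree , eq , agree′) = recv-step β b t agree eq agree′

  ⊢⇒ProductEdge : ∀ {S C S′ C′} → (S , C) ⊢ (S′ , C′) → ProductEdge S S′
  ⊢⇒ProductEdge s = let j , a , t , agree , _ = ⊢⇒Step s in j , agree , a , t

  -- Images along edges of the product graph.

  Leads : ∀ {j} → State j × Action graph Message j × State j → Rel CompositeState 0ℓ
  Leads {j} (p , _ , q) S S′ = p ≡ lookup S j × q ≡ lookup S′ j × AgreeExceptAt j S S′

  leads? : ∀ {j} (t : State j × Action graph Message j × State j) S S′ → Dec (Leads t S S′)
  leads? {j} (p , _ , q) S S′ = (p Fin.≟ lookup S j) ×-dec (q Fin.≟ lookup S′ j) ×-dec
    all? (λ i → ¬? (i Fin.≟ j) →-dec (lookup S i Fin.≟ lookup S′ i))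

  -- Several machines and transitions may lead from `S` to `S′`, in particular when the two
  -- coincide; the images under all of them are collected.
  post : CompositeState → CompositeState → List Box → List Box
  post S S′ Bs = concatMap (λ j → concatMap (λ t → guard (leads? t S S′) (map (fire (proj₁ (proj₂ t))) Bs))
                                            (transitions j))
                           (allFin nodes)

  post-sound : ∀ S S′ Bs {C′} → C′ ∈ ⟦ post S S′ Bs ⟧ → ∃[ C ] ((S , C) ⊢ (S′ , C′)) × C ∈ ⟦ Bs ⟧
  post-sound S S′ Bs C′∈
    with j , _ , C′∈j ← find (concatMap⁻ _ {xs = allFin nodes} C′∈)
    with (p , a , q) , t∈ , C′∈t ← find (concatMap⁻ _ {xs = transitions j} C′∈j)
    with (refl , refl , agree) , C′∈a ← Any-guard⁻ (leads? (p , a , q) S S′) C′∈t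
    with B , B∈ , C′∈B ← find (Any.map⁻ C′∈a)
    with C , fires , C∈B ← fire-sound a B C′∈B
    = C , Step⇒⊢ (j , a , t∈ , agree , fires) , lose B∈ C∈B

  post-complete : ∀ S S′ Bs {C C′} → (S , C) ⊢ (S′ , C′) → C ∈ ⟦ Bs ⟧ → C′ ∈ ⟦ post S S′ Bs ⟧
  post-complete S S′ Bs s C∈ =
    let j , a , t , agree , fires = ⊢⇒Step s
        B , B∈ , C∈B = find C∈
    in concatMap⁺ _ (lose (∈-allFin j) (concatMap⁺ _ (lose t
         (Any-guard⁺ (leads? (lookup S j , a , lookup S′ j) S S′) (refl , refl , agree)
           (Any.map⁺ (lose B∈ (fire-complete a B fires C∈B)))))))

  compositeStates : Enumeration CompositeState
  compositeStates = tuples (λ j → allFin _) , λ S → ∈-tuples⁺ _ S (λ j → ∈-allFin _)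

  Consistent-⊢ : ∀ {R : Family} → (∀ {S C S′ C′} → (S , C) ⊢ (S′ , C′) → C ∈ R S → C′ ∈ R S′) → Consistent R
  Consistent-⊢ closed ε        C∈ = C∈
  Consistent-⊢ closed (s ◅ ss) C∈ = Consistent-⊢ closed ss (closed s C∈)

  -- The smallest consistent extension.

  module Extension (V : CompositeState → Bool) (fvs : FeedbackVertexSet V)
                   (R₀ : FamilyOn V) (rec : ∀ S (v : T (V S)) → Recognizable (R₀ S v)) where

    -- Derivation Ss S C: a computation that starts in the given relations,
    -- stays outside V afterwards and ends in (S , C); Ss lists the composite
    -- states visited after the start, the last one first.
    data Derivation : List CompositeState → CompositeState → ChannelContent → Set where
      start : ∀ {S C} (v : T (V S)) → C ∈ R₀ S v → Derivation [] S C
      step  : ∀ {Ss S C S′ C′} → ¬ T (V S′) → Derivation Ss S C → (S , C) ⊢ (S′ , C′) →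
              Derivation (S′ ∷ Ss) S′ C′

    derivation-Linked : ∀ {Ss S C} → Derivation Ss S C → Linked (flip ProductEdge) Ss
    derivation-Linked (start _ _)               = []
    derivation-Linked (step _ (start _ _) _)    = [-]
    derivation-Linked (step _ d@(step _ _ _) s) = ⊢⇒ProductEdge s ∷ derivation-Linked d

    derivation-avoids : ∀ {Ss S C} → Derivation Ss S C → All (¬_ ∘ T ∘ V) Ss
    derivation-avoids (start _ _)   = []
    derivation-avoids (step ¬v d _) = ¬v ∷ derivation-avoids d

    bound : ℕ
    bound = length (proj₁ compositeStates)

    -- A repeated composite state would close a cycle outside `V`, which a feedback vertex set
    -- excludes; so the visited states are distinct.
    derivation-length : ∀ {Ss S C} → Derivation Ss S C → length Ss ≤ bound
    derivation-length d = Unique⇒length≤ compositeStates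
      (walk-Unique (λ S Ss u l → fvs S Ss (u , l)) (derivation-Linked d) (derivation-avoids d))

    -- The decision is an argument so that lemmas can split on it.
    extend : ∀ S → Dec (T (V S)) → List Box → List Box
    extend S (yes v) _  = boxes (rec S v)
    extend S (no _)  Bs = Bs

    extend-on : ∀ {S} (d : Dec (T (V S))) v Bs → ⟦ extend S d Bs ⟧ ≐ R₀ S v
    -- The given relation is indexed by the proof of membership in `V`, so the two proofs must be
    -- identified.
    extend-on (yes v′) v Bs rewrite T-irrelevant v′ v = boxes-correct (rec _ v)
    extend-on (no ¬v)  v Bs = contradiction v ¬v

    extend-off : ∀ {S} (d : Dec (T (V S))) Bs → ¬ T (V S) → extend S d Bs ≡ Bs
    extend-off (yes v) Bs ¬v = contradiction v ¬v
    extend-off (no _)  Bs ¬v = refl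

    -- Stage n holds what derivations of at most n steps reach; on `V` every stage is the given
    -- relation.
    stage : ℕ → CompositeState → List Box
    step-boxes : ℕ → CompositeState → List Box
    step-boxes zero    S = []
    step-boxes (suc n) S = concatMap (λ S₀ → post S₀ S (stage n S₀)) (proj₁ compositeStates)
    stage n S = extend S (T? (V S)) (step-boxes n S)

    stage-on : ∀ n S v → ⟦ stage n S ⟧ ≐ R₀ S v
    stage-on n S v = extend-on (T? (V S)) v (step-boxes n S)

    stage-complete : ∀ {Ss S C} n → Derivation Ss S C → length Ss ≤ n → C ∈ ⟦ stage n S ⟧
    stage-complete n (start v C∈) _ = proj₂ (stage-on n _ v) C∈
    stage-complete {S = S} (suc n) (step {S = S₀} ¬v d s) (s≤s len)
      rewrite extend-off (T? (V S)) (step-boxes (suc n) S) ¬v =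
      concatMap⁺ _ (lose (proj₂ compositeStates S₀) (post-complete S₀ S _ s (stage-complete n d len)))

    stage-sound : ∀ n S {C} → C ∈ ⟦ stage n S ⟧ → ∃[ Ss ] Derivation Ss S C
    stage-sound n S C∈ with T? (V S)
    ... | yes v = [] , start v (proj₁ (boxes-correct (rec S v)) C∈)
    stage-sound (suc n) S C∈ | no ¬v =
      let S₀ , _ , C∈₀ = find (concatMap⁻ _ {xs = proj₁ compositeStates} C∈)
          C₀ , s , C₀∈ = post-sound S₀ S (stage n S₀) C∈₀
          Ss , d = stage-sound n S₀ C₀∈
      in S ∷ Ss , step ¬v d s

    limit : CompositeState → List Box
    limit = stage bound

    limit-complete : ∀ {Ss S C} → Derivation Ss S C → C ∈ ⟦ limit S ⟧
    limit-complete d = stage-complete bound d (derivation-length d)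

    -- A consistent extension contains the given relations and is closed under steps, hence contains
    -- the end of every derivation.
    limit-least : ∀ R → ConsistentExtension R₀ R → ∀ S → ⟦ limit S ⟧ ⊆ R S
    limit-least R (agrees , consistent) S C∈ = go (proj₂ (stage-sound bound S C∈))
      where
      go : ∀ {Ss S C} → Derivation Ss S C → C ∈ R S
      go (start v C∈) = proj₂ (agrees _ v) C∈
      go (step _ d s) = consistent (s ◅ ε) (go d)

    -- Steps to states outside `V` stay within `limit` by construction, so only a step into `V` can
    -- break consistency.
    ClosedOnV : Set
    ClosedOnV = ∀ S S′ → T (V S′) → ∀ C → C ∈ ⟦ post S S′ (limit S) ⟧ → C ∈ ⟦ limit S′ ⟧

    closedOnV? : Dec ClosedOnV
    closedOnV? = ∀? (λ S → ∀? (λ S′ → T? (V S′) →-dec (post S S′ (limit S) ⊆? limit S′)))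
      where
      ∀? : {Q : CompositeState → Set} → (∀ S → Dec (Q S)) → Dec (∀ S → Q S)
      ∀? Q? = map′ (λ h S → All.lookup h (proj₂ compositeStates S)) (λ h → All.tabulate (λ _ → h _))
                   (All.all? Q? (proj₁ compositeStates))

    -- An extension contains `limit`, so a step into `V` lands in its relation there, which is the
    -- given one and hence `limit`.
    extendable⇒closedOnV : Extendable R₀ → ClosedOnV
    extendable⇒closedOnV (R , ext@(agrees , consistent)) S S′ v C′ C′∈ =
      let C , s , C∈ = post-sound S S′ (limit S) C′∈
      in proj₂ (stage-on bound S′ v) (proj₁ (agrees S′ v) (consistent (s ◅ ε) (limit-least R ext S C∈)))

    closedOnV⇒smallest : ClosedOnV → SmallestConsistentExtension R₀ (⟦_⟧ ∘ limit)
    closedOnV⇒smallest closed = (stage-on bound , Consistent-⊢ closed-⊢) , limit-least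
      where
      closed-⊢ : ∀ {S C S′ C′} → (S , C) ⊢ (S′ , C′) → C ∈ ⟦ limit S ⟧ → C′ ∈ ⟦ limit S′ ⟧
      closed-⊢ {S} {C} {S′} {C′} s C∈ = case T? (V S′) of λ where
        (yes v) → closed S S′ v C′ (post-complete S S′ (limit S) s C∈)
        -- The lengthened derivation still fits within `bound`.
        (no ¬v) → limit-complete (step ¬v (proj₂ (stage-sound bound S C∈)) s)

theorem9p8 : (P : Protocol) → let open Protocol P in
    (V : CompositeState → Bool) → FeedbackVertexSet V →
    (R₀ : FamilyOn V) → (∀ S (v : T (V S)) → Recognizable (R₀ S v)) →
    Dec (Extendable R₀) ×
    (Extendable R₀ →
    ∃[ R ] SmallestConsistentExtension R₀ R ×
    (∀ S → ¬ T (V S) → Recognizable (R S)))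
theorem9p8 P V fvs R₀ rec =
  map′ (λ closed → _ , proj₁ (closedOnV⇒smallest closed)) extendable⇒closedOnV closedOnV? ,
  λ ext → _ , closedOnV⇒smallest (extendable⇒closedOnV ext) , λ S _ → ⟦⟧-recognizable P (limit S)
  where open Extension P V fvs R₀ rec
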